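{- Let $\mathrm{Prop}$ be any finite set of propositional variables. Then the concept class $\mathbb{C}(\mathcal{F}_{\mathrm{fin}},\mathcal{L}_{\mathrm{full}}[\mathrm{Prop}])$ does not admit finite characterisations. In fact, no modal formula $\varphi\in\mathcal{L}_{\mathrm{full}}[\mathrm{Prop}]$ has a finite characterisation with respect to $\mathbb{C}(\mathcal{F}_{\mathrm{fin}},\mathcal{L}_{\mathrm{full}}[\mathrm{Prop}])$. The same holds for $\mathbb{C}(\mathcal{F}_{\mathrm{all}},\mathcal{L}_{\mathrm{full}}[\mathrm{Prop}])$.
   Context: $\mathcal{L}_{\mathrm{full}}[\mathrm{Prop}]$ is the set of all modal formulas generated by $\varphi::=\top\mid\bot\mid p\mid\neg p\mid(\varphi\wedge\varphi)\mid(\varphi\vee\varphi)\mid\Diamond\varphi\mid\Box\varphi$ with $p\in\mathrm{Prop}$ (negation only in front of variables). A Kripke model over $\mathrm{Prop}$ is $M=(dom(M),R,v)$ with $R\subseteq dom(M)\times dom(M)$ and $v:dom(M)\to\mathcal{P}(\mathrm{Prop})$; its frame is $(dom(M),R)$; a pointed model is a pair $(M,s)$ with $s\in dom(M)$. Satisfaction is the standard Kripke semantics. $\mathcal{F}_{\mathrm{all}}$ is the class of all frames and $\mathcal{F}_{\mathrm{fin}}$ the class of all finite frames. For a class $\mathcal{F}$ of frames and a set $\mathcal{L}[\mathrm{Prop}]$ of modal formulas, $\mathbb{C}(\mathcal{F},\mathcal{L}[\mathrm{Prop}])$ is the concept class whose examples are the pointed models over $\mathrm{Prop}$ whose frame is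 in $\mathcal{F}$, whose concepts are the formulas in $\mathcal{L}[\mathrm{Prop}]$, and in which an example $(M,s)$ is positive for $\varphi$ if $M,s\models\varphi$ and negative otherwise. A formula $\varphi$ fits a pair $(E^+,E^-)$ of finite sets of examples if every element of $E^+$ is a positive example and every element of $E^-$ is a negative example for $\varphi$. A finite characterisation of $\varphi$ with respect to this concept class is a pair $(E^+,E^-)$ of finite sets of examples such that $\varphi$ fits $(E^+,E^-)$ and every $\psi\in\mathcal{L}[\mathrm{Prop}]$ that fits $(E^+,E^-)$ has the same positive examples as $\varphi$. The concept class admits finite characterisations if each of its formulas has one. -}

module Defs where

open import Level using (Level; _⊔_; suc)
open import Data.Nat.Base using (ℕ)
open import Data.Fin.Base using (Fin)
open import Data.List.Base using (List)
open import Data.List.Relation.Unary.All using (All)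
open import Data.Product.Base using (Σ; Σ-syntax; ∃; ∃-syntax; _×_; _,_; proj₁)
open import Data.Sum.Base using (_⊎_)
open import Data.Empty.Polymorphic using (⊥)
open import Data.Unit.Polymorphic.Base using (⊤)
open import Function.Bundles using (_↔_; _⇔_)
open import Relation.Binary.Core using (Rel)
open import Relation.Nullary.Negation.Core using (¬_)
open import Relation.Unary using (Pred)

Finite : ∀ {a} → Set a → Set a
Finite A = ∃[ n ] (A ↔ Fin n)

infix  9 ◇_ □_
infixr 7 _∧ᶠ_
infixr 6 _∨ᶠ_

-- Negation is applied to variables only, so it is the constructor ¬var.

data ℒ-full {p : Level} (Var : Set p) : Set p where
  ⊤ᶠ ⊥ᶠ     : ℒ-full Var
  var ¬var  : Var → ℒ-full Var
  _∧ᶠ_ _∨ᶠ_ : ℒ-full Var → ℒ-full Var → ℒ-full Var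
  ◇_ □_     : ℒ-full Var → ℒ-full Var

record Frame (ℓ : Level) : Set (suc ℓ) where
  field
    dom : Set ℓ
    R   : Rel dom ℓ

record Model {p : Level} (Var : Set p) (ℓ : Level) : Set (p ⊔ suc ℓ) where
  field
    frame : Frame ℓ
  open Frame frame public
  field
    v : dom → Pred Var ℓ

record PointedModel {p : Level} (Var : Set p) (ℓ : Level) : Set (p ⊔ suc ℓ) where
  constructor _,ₚ_
  field
    model : Model Var ℓ
    point : Model.dom model

module _ {p ℓ : Level} {Var : Set p} where

  infix 4 _,_⊨_

  _,_⊨_ : (M : Model Var ℓ) → Model.dom M → ℒ-full Var → Set ℓ
  M , s ⊨ ⊤ᶠ       = ⊤
  M , s ⊨ ⊥ᶠ       = ⊥
  M , s ⊨ var x    = Model.v M s x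
  M , s ⊨ ¬var x   = ¬ Model.v M s x
  M , s ⊨ (φ ∧ᶠ ψ) = (M , s ⊨ φ) × (M , s ⊨ ψ)
  M , s ⊨ (φ ∨ᶠ ψ) = (M , s ⊨ φ) ⊎ (M , s ⊨ ψ)
  M , s ⊨ (◇ φ)    = ∃[ t ] (Model.R M s t × (M , t ⊨ φ))
  M , s ⊨ (□ φ)    = ∀ t → Model.R M s t → M , t ⊨ φ

FrameClass : (ℓ : Level) → Set (suc ℓ)
FrameClass ℓ = Pred (Frame ℓ) ℓ

ℱ-all : ∀ {ℓ} → FrameClass ℓ
ℱ-all _ = ⊤

-- Only the domain is required to be finite; R may be any relation on it,
-- not necessarily a decidable one.

ℱ-fin : ∀ {ℓ} → FrameClass ℓ
ℱ-fin F = Finite (Frame.dom F)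

record ConceptClass (e c ℓ : Level) : Set (suc (e ⊔ c ⊔ ℓ)) where
  field
    Example  : Set e
    Concept  : Set c
    Positive : Example → Concept → Set ℓ

  Negative : Example → Concept → Set ℓ
  Negative x φ = ¬ Positive x φ

  -- A finite set of examples is given by a list of its elements; order and
  -- multiplicity play no role, since the lists are only used through All.

  Fits : Concept → List Example × List Example → Set (e ⊔ ℓ)
  Fits φ (E⁺ , E⁻) = All (λ x → Positive x φ) E⁺ × All (λ x → Negative x φ) E⁻

  SamePositives : Concept → Concept → Set (e ⊔ ℓ)
  SamePositives ψ φ = ∀ x → Positive x ψ ⇔ Positive x φ

  IsFiniteCharacterisation : Concept → List Example × List Example → Set (e ⊔ c ⊔ ℓ)
  IsFiniteCharacterisation φ E = Fits φ E × (∀ ψ → Fits ψ E → SamePositives ψ φ)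

  HasFiniteCharacterisation : Concept → Set (e ⊔ c ⊔ ℓ)
  HasFiniteCharacterisation φ = ∃ (IsFiniteCharacterisation φ)

  AdmitsFiniteCharacterisations : Set (e ⊔ c ⊔ ℓ)
  AdmitsFiniteCharacterisations = ∀ φ → HasFiniteCharacterisation φ

open ConceptClass public using (HasFiniteCharacterisation; AdmitsFiniteCharacterisations)

ℂ-full : ∀ {p ℓ} → FrameClass ℓ → (Var : Set p) → ConceptClass (p ⊔ suc ℓ) p ℓ
ℂ-full {ℓ = ℓ} ℱ Var = record
  { Example  = Σ[ Ms ∈ PointedModel Var ℓ ] ℱ (Model.frame (PointedModel.model Ms))
  ; Concept  = ℒ-full Var
  ; Positive = λ x φ → PointedModel.model (proj₁ x) , PointedModel.point (proj₁ x) ⊨ φ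
  }

{-# OPTIONS --safe #-}
module Submission where

-- Let χₙ = ◇ⁿ⊤ ∧ □ⁿ⁺¹⊥ say that the longest path from the point has length
-- exactly n. A pointed model satisfies χₙ for at most one n, so finitely many
-- examples all refute χₙ for every large n. For such n, both φ ∨ χₙ and φ ∧ ¬χₙ
-- agree with φ on the examples, but on a chain of height n, where χₙ holds, one
-- of the two disagrees with φ. The bound is stated as ∃ N ∀ n ≥ N ¬¬ because,
-- constructively, ¬¬ does not commute with ∀ n.

open import Defs
open import Data.Empty.Polymorphic using (⊥; ⊥-elim)
open import Data.Fin.Base using (Fin; toℕ; fromℕ; fromℕ<)
open import Data.Fin.Properties using (toℕ<n; toℕ-fromℕ; toℕ-fromℕ<)
open import Data.List.Base using (List; []; _∷_; _++_)
open import Data.List.Relation.Unary.All as All using (All; []; _∷_)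
open import Data.List.Relation.Unary.All.Properties using (++⁻)
open import Data.Nat.Base using (ℕ; zero; suc; _≤_; _<_; _⊔_; z≤n; s≤s)
open import Data.Nat.GeneralisedArithmetic using (fold)
open import Data.Nat.Properties
  using (≤-refl; ≤-reflexive; ≤-trans; <-trans; <⇒≱; m≤m⊔n; m≤n⊔m)
open import Data.Product.Base using (_×_; _,_; ∃-syntax; proj₁; proj₂)
open import Data.Sum.Base using (inj₁; inj₂; [_,_])
open import Function.Base using (_∘_)
open import Function.Bundles using (mk↔ₛ′; module Equivalence)
open import Level using (Level; Lift; lift; lower)
open import Relation.Binary.PropositionalEquality.Core using (refl; sym; subst)
open import Relation.Nullary.Negation.Core using (¬_; contradiction)

module _ {p : Level} {Var : Set p} where

  ◇^_ □^_ : ℕ → ℒ-full Var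
  ◇^ n = fold ⊤ᶠ ◇_ n
  □^ n = fold ⊥ᶠ □_ n

  -- `lacksHeight n` is the negation normal form of the negated `hasHeight n`, since the syntax
  -- negates only variables.
  hasHeight lacksHeight : ℕ → ℒ-full Var
  hasHeight   n = ◇^ n ∧ᶠ □^ suc n
  lacksHeight n = □^ n ∨ᶠ ◇^ suc n

  module _ {ℓ : Level} (M : Model Var ℓ) where

    ◇^⇒¬□^ : ∀ n {s} → M , s ⊨ ◇^ n → ¬ (M , s ⊨ □^ n)
    ◇^⇒¬□^ zero    _            ()
    ◇^⇒¬□^ (suc n) (t , Rst , d) b = ◇^⇒¬□^ n d (b t Rst)

    -- No excluded middle is involved: `□^ n` unfolds to a statement ending in falsity, so a
    -- refutation of paths proves it directly.
    ¬◇^⇒□^ : ∀ n {s} → ¬ (M , s ⊨ ◇^ n) → M , s ⊨ □^ n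
    ¬◇^⇒□^ zero    ¬d       = contradiction _ ¬d
    ¬◇^⇒□^ (suc n) ¬d t Rst = ¬◇^⇒□^ n λ d → ¬d (t , Rst , d)

    □^-mono : ∀ {m n s} → m ≤ n → M , s ⊨ □^ m → M , s ⊨ □^ n
    □^-mono z≤n       b       = ⊥-elim b
    □^-mono (s≤s m≤n) b t Rst = □^-mono m≤n (b t Rst)

    lacksHeight⇒¬hasHeight : ∀ n {s} → M , s ⊨ lacksHeight n → ¬ (M , s ⊨ hasHeight n)
    lacksHeight⇒¬hasHeight n (inj₁ b) (d , _) = ◇^⇒¬□^ n d b
    lacksHeight⇒¬hasHeight n (inj₂ d) (_ , b) = ◇^⇒¬□^ (suc n) d b

    -- A failure at `n` refutes `◇^ suc n`, hence gives `□^ suc n` and, by monotonicity, the left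
    -- disjunct at all later indices.
    eventually-lacksHeight : ∀ s →
      ¬ ¬ (∃[ N ] (∀ n → N ≤ n → ¬ ¬ (M , s ⊨ lacksHeight n)))
    eventually-lacksHeight s k =
      -- The bound 0 is tried first; a failure `¬l` at `n` replaces it by `suc n` in a second call
      -- of `k`.
      k (0 , λ n _ ¬l → k (suc n , λ m n<m ¬l′ →
        ¬l′ (inj₁ (□^-mono n<m (¬◇^⇒□^ (suc n) (¬l ∘ inj₂))))))

chain : ∀ ℓ → ℕ → Frame ℓ
chain ℓ n = record
  { dom = Lift ℓ (Fin (suc n))
  ; R   = λ i j → Lift ℓ (toℕ (lower j) < toℕ (lower i))
  }

top : ∀ {ℓ} n → Frame.dom (chain ℓ n)
top n = lift (fromℕ n)

chain-finite : ∀ {ℓ} n → ℱ-fin (chain ℓ n)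
chain-finite n = suc n , mk↔ₛ′ lower lift (λ _ → refl) (λ _ → refl)

module _ {p ℓ : Level} {Var : Set p} (n : ℕ) where

  chainModel : Model Var ℓ
  chainModel = record { frame = chain ℓ n ; v = λ _ _ → ⊥ }

  ≤⇒◇^ : ∀ m i → m ≤ toℕ (lower i) → chainModel , i ⊨ ◇^ m
  ≤⇒◇^ zero    _ _   = _
  ≤⇒◇^ (suc m) i m<i =
    -- As `R` is the whole strict order, one step leads straight to the world numbered `m`.
    lift (fromℕ< m<1+n) , lift (subst (_< _) (sym toℕ≡m) m<i) ,
    ≤⇒◇^ m _ (≤-reflexive (sym toℕ≡m))
    where
    m<1+n = <-trans m<i (toℕ<n (lower i))
    toℕ≡m = toℕ-fromℕ< m<1+n

  ◇^⇒≤ : ∀ m i → chainModel , i ⊨ ◇^ m → m ≤ toℕ (lower i)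
  ◇^⇒≤ zero    _ _                  = z≤n
  ◇^⇒≤ (suc m) i (j , lift j<i , d) = ≤-trans (s≤s (◇^⇒≤ m j d)) j<i

  chain-hasHeight : chainModel , top n ⊨ hasHeight n
  chain-hasHeight =
    ≤⇒◇^ n (top n) (≤-reflexive (sym (toℕ-fromℕ n))) ,
    ¬◇^⇒□^ chainModel (suc n) λ d →
      <⇒≱ (◇^⇒≤ (suc n) (top n) d) (≤-reflexive (toℕ-fromℕ n))

module _ {p ℓ : Level} {Var : Set p} (ℱ : FrameClass ℓ) where

  open ConceptClass (ℂ-full ℱ Var) hiding (HasFiniteCharacterisation)
  open PointedModel

  -- The maximum of the bounds serves all examples; each double negation can be opened because the
  -- goal is itself negated.
  eventually-all-lackHeight : (E : List Example) →
    ¬ ¬ (∃[ N ] (∀ n → N ≤ n → ¬ ¬ All (λ x → Positive x (lacksHeight n)) E))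
  eventually-all-lackHeight []      k = k (0 , λ _ _ ¬[] → ¬[] [])
  eventually-all-lackHeight ((record { model = M ; point = s } , _) ∷ E) k =
    eventually-lacksHeight M s λ (N₁ , l) →
    eventually-all-lackHeight E λ (N₂ , ls) →
    k (N₁ ⊔ N₂ , λ n N≤n ¬all →
      l  n (≤-trans (m≤m⊔n N₁ N₂) N≤n) λ px →
      ls n (≤-trans (m≤n⊔m N₁ N₂) N≤n) λ pxs →
      ¬all (px ∷ pxs))

  all-lackHeight : (E : List Example) →
    ¬ ¬ (∃[ n ] All (λ x → Positive x (lacksHeight n)) E)
  all-lackHeight E k = eventually-all-lackHeight E λ (N , ls) →
    ls N ≤-refl λ all → k (N , all)

  noFiniteCharacterisation : (∀ n → ℱ (chain ℓ n)) →
    (φ : ℒ-full Var) → ¬ HasFiniteCharacterisation (ℂ-full ℱ Var) φ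
  noFiniteCharacterisation ℱ-chain φ ((E⁺ , E⁻) , (φ⁺ , φ⁻) , unique) =
    -- The goal is falsity, so `n` may be extracted from under the double negation.
    all-lackHeight (E⁺ ++ E⁻) λ (n , lacks) →
      let lacks⁺ , lacks⁻ = ++⁻ E⁺ lacks

          ∨-fits : Fits (φ ∨ᶠ hasHeight n) (E⁺ , E⁻)
          ∨-fits = All.map inj₁ φ⁺ , All.zipWith
            (λ {x} (¬φ , l) → [ ¬φ , lacksHeight⇒¬hasHeight (model (proj₁ x)) n l ])
            (φ⁻ , lacks⁻)

          ∧-fits : Fits (φ ∧ᶠ lacksHeight n) (E⁺ , E⁻)
          ∧-fits = All.zip (φ⁺ , lacks⁺) , All.map (_∘ proj₁) φ⁻

          C : Example
          C = (chainModel n ,ₚ top n) , ℱ-chain n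

          -- No case split on `φ` at `C`: the disjunction forces `φ` there, and then the conjunction
          -- forces `lacksHeight n`.
          C⊨φ = Equivalence.to (unique (φ ∨ᶠ hasHeight n) ∨-fits C) (inj₂ (chain-hasHeight n))
          C-lacksHeight = proj₂ (Equivalence.from (unique (φ ∧ᶠ lacksHeight n) ∧-fits C) C⊨φ)
      in lacksHeight⇒¬hasHeight (chainModel n) n C-lacksHeight (chain-hasHeight n)

theorem3p5 : ∀ {p ℓ : Level} (Var : Set p) → Finite Var →
    ((¬ AdmitsFiniteCharacterisations (ℂ-full {p} {ℓ} ℱ-fin Var)) ×
    ((φ : ℒ-full Var) → ¬ HasFiniteCharacterisation (ℂ-full {p} {ℓ} ℱ-fin Var) φ)) ×
    ((¬ AdmitsFiniteCharacterisations (ℂ-full {p} {ℓ} ℱ-all Var)) ×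
    ((φ : ℒ-full Var) → ¬ HasFiniteCharacterisation (ℂ-full {p} {ℓ} ℱ-all Var) φ))
theorem3p5 Var _ =
  ((λ admits → none-fin ⊤ᶠ (admits ⊤ᶠ)) , none-fin) ,
  ((λ admits → none-all ⊤ᶠ (admits ⊤ᶠ)) , none-all)
  where
  none-fin = noFiniteCharacterisation ℱ-fin chain-finite
  -- Membership in `ℱ-all` is the unit type, so the condition on chains is inferred.
  none-all = noFiniteCharacterisation ℱ-all _
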